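{- There exists an absolute constant $c>0$ such that for every positive integer $n$ there exists a permutation $\pi$ of an $n$-element set $\{0,\dots,n-1\}$ whose Hasse diagram $G$ satisfies $$\alpha(G)\leq n\,2^{ -c\sqrt{\log n}}\quad\text{and}\quad \chi(G)\geq 2^{c\sqrt{\log n}}.$$
   Context: The Hasse diagram of a permutation $\pi$ of $[n]=\{0,\dots,n-1\}$ is the graph on vertex set $[n]$ in which vertices $i<j$ are joined by an edge if and only if $\pi(i)<\pi(j)$ and there is no $\ell$ with $i<\ell<j$ and $\pi(i)<\pi(\ell)<\pi(j)$. (Equivalently, it is the Hasse diagram, i.e. the graph of covering pairs, of the 2-dimensional poset on the points $(i,\pi(i))$, $i\in[n]$, with the coordinatewise order.) For a graph $G$, $\alpha(G)$ denotes its independence number (the maximum size of a set of pairwise non-adjacent vertices) and $\chi(G)$ its chromatic number. The base of $\log$ (any fixed base greater than $1$) is immaterial, as it only affects the constant $c$. -}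

module Defs where

open import Data.Fin.Base as Fin using (Fin)
open import Data.Fin.Permutation using (Permutation′; _⟨$⟩ʳ_)
open import Data.Fin.Properties using (<-irrefl)
open import Data.Fin.Subset using (Subset; _∈_; ∣_∣)
open import Data.Integer.Base as ℤ using ()
open import Data.Nat.Base using (ℕ; NonZero; _*_; _^_; _≤_)
open import Data.Product.Base using (_×_; _,_; ∃-syntax)
open import Data.Rational.Base using (ℚ; ↥_; ↧ₙ_)
open import Data.Sum.Base using (_⊎_; inj₁; inj₂; swap)
open import Level using (0ℓ)
open import Relation.Binary.Core using (Rel)
open import Relation.Binary.Definitions using (Symmetric)
open import Relation.Binary.PropositionalEquality using (_≡_; _≢_; refl)
open import Relation.Nullary.Negation using (¬_)

record Graph (n : ℕ) : Set₁ where
  field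
    Adj    : Rel (Fin n) 0ℓ
    sym    : Symmetric Adj
    irrefl : ∀ {i} → ¬ Adj i i

open Graph public using (Adj)

IsIndependent : ∀ {n} → Graph n → Subset n → Set
IsIndependent G S = ∀ i j → i ∈ S → j ∈ S → ¬ Adj G i j

IsIndependenceNumber : ∀ {n} → Graph n → ℕ → Set
IsIndependenceNumber {n} G α =
  (∃[ S ] IsIndependent G S × ∣ S ∣ ≡ α) ×
  ((S : Subset n) → IsIndependent G S → ∣ S ∣ ≤ α)

IsProperColouring : ∀ {n k} → Graph n → (Fin n → Fin k) → Set
IsProperColouring G f = ∀ i j → Adj G i j → f i ≢ f j

Colourable : ∀ {n} → Graph n → ℕ → Set
Colourable {n} G k = ∃[ f ] IsProperColouring {n} {k} G f

IsChromaticNumber : ∀ {n} → Graph n → ℕ → Set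
IsChromaticNumber G χ = Colourable G χ × (∀ k → Colourable G k → χ ≤ k)

Covers : ∀ {n} → Permutation′ n → Rel (Fin n) 0ℓ
Covers π i j =
  i Fin.< j ×
  π ⟨$⟩ʳ i Fin.< π ⟨$⟩ʳ j ×
  ¬ (∃[ ℓ ] i Fin.< ℓ × ℓ Fin.< j ×
            π ⟨$⟩ʳ i Fin.< π ⟨$⟩ʳ ℓ × π ⟨$⟩ʳ ℓ Fin.< π ⟨$⟩ʳ j)

hasseDiagram : ∀ {n} → Permutation′ n → Graph n
hasseDiagram π = record
  { Adj    = λ i j → Covers π i j ⊎ Covers π j i
  ; sym    = swap
  ; irrefl = λ { (inj₁ (i<i , _)) → <-irrefl refl i<i
               ; (inj₂ (i<i , _)) → <-irrefl refl i<i }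
  }

-- A real number x ≥ 0 is given by the set of fractions a / b (a, b natural,
-- b ≥ 1) with a / b ≤ x:  x a b  is read  a / b ≤ x.  Values at b = 0 carry no
-- meaning and are never used.
Cut : Set₁
Cut = ℕ → ℕ → Set

infix  8 √_ log₂_
infixr 7 _·_
infix  4 2^_≤_ _≤_·2^-_

-- For n ≥ 1:  a / b ≤ log₂ n  iff  2 ^ a ≤ n ^ b.
log₂_ : ℕ → Cut
(log₂ n) a b = 2 ^ a ≤ n ^ b

-- a / b ≤ √ x  iff  a² / b² ≤ x.
√_ : Cut → Cut
(√ x) a b = x (a * a) (b * b)

-- For c > 0 only:  a / b ≤ c x  iff  (a / b) / c ≤ x.
_·_ : ℚ → Cut → Cut
(c · x) a b = x (a * ↧ₙ c) (b * ℤ.∣ ↥ c ∣)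

-- 2 ^ x is the supremum of 2 ^ (a / b) over a / b ≤ x, and
-- 2 ^ (a / b) ≤ m  iff  2 ^ a ≤ m ^ b.
2^_≤_ : Cut → ℕ → Set
2^ x ≤ m = ∀ a b .{{_ : NonZero b}} → x a b → 2 ^ a ≤ m ^ b

-- 2 ^ (- x) is the infimum of 2 ^ (- a / b) over a / b ≤ x, and
-- m ≤ n 2 ^ (- a / b)  iff  m ^ b 2 ^ a ≤ n ^ b.
_≤_·2^-_ : ℕ → ℕ → Cut → Set
m ≤ n ·2^- x = ∀ a b .{{_ : NonZero b}} → x a b → m ^ b * 2 ^ a ≤ n ^ b

{-# OPTIONS --safe #-}
module Submission where

-- A permutation is grown level by level.  Given one on n points all of whose independent sets
-- lie in few "containers" of size ≤ u, take m copies of it side by side (the columns), and let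
-- the m copies of each point i form a row, consecutive in the vertical order.  Inside a row
-- every point gets a bit; low points (bit false) are put below high points (bit true), and
-- each of the two classes is decreasing.  Edges within columns survive, and in a row each low
-- point is joined to every high point to its right.  So an independent set chooses a container
-- in each column and a cut in each row, and keeps only the high points before and the low
-- points after the cut.  For random bits a fixed choice keeps half of at most m u points on
-- average; since a fair bit b satisfies E[3^b] = 2 and 2^6 ≤ 3^4, a union bound over the
-- choices gives bits for which every choice keeps at most 4/5 of m u points, as long as the
-- number of choices is at most 2^(m u / 5).  For k levels m = 2^O(k) suffices, so on
-- 2^O(k²) points the independence number has density (4/5)^k.

open import Defs
open import Data.Bool.Base using (Bool; true; false; _∧_; if_then_else_; not)
open import Data.Bool.Properties using (T-≡)
open import Data.Empty using (⊥; ⊥-elim)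
open import Data.Fin.Base as Fin
  using (Fin; zero; suc; toℕ; fromℕ<; punchOut; combine; remQuot; opposite; finToFun; funToFin)
open import Data.Fin.Patterns using (0F; 1F)
open import Data.Fin.Permutation using (Permutation′; permutation; _⟨$⟩ʳ_)
import Data.Fin.Properties as Fin
open import Data.Fin.Subset as Subset using (Subset; ∣_∣)
import Data.Fin.Subset.Properties as Subset
import Data.Integer.Base as ℤ
open import Data.Nat.Base
open import Data.Nat.Coprimality using (1-coprimeTo)
open import Data.Nat.DivMod using (m≡m%n+[m/n]*n; m%n<n)
open import Data.Nat.Properties
open import Data.Nat.Tactic.RingSolver using (solve-∀)
open import Data.Product.Base using (Σ-syntax; ∃-syntax; ∃; _×_; _,_; proj₁; proj₂)
open import Data.Rational.Base as ℚ using (ℚ; 0ℚ)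
open import Data.Sum.Base using (_⊎_; inj₁; inj₂; [_,_]′)
open import Data.Vec.Base using (lookup; tabulate; []; _∷_)
open import Data.Vec.Functional using (Vector)
open import Data.Vec.Properties using (lookup∘tabulate; []=⇒lookup; lookup⇒[]=)
open import Function.Base using (_∘_; id)
open import Function.Bundles using (Equivalence)
open import Function.Definitions using (Injective)
open import Relation.Binary.Definitions using (tri<; tri≈; tri>)
open import Relation.Binary.PropositionalEquality
  using (_≡_; _≢_; refl; sym; trans; cong; cong₂; subst; subst₂; module ≡-Reasoning)
open import Relation.Nullary
  using (¬_; Dec; yes; no; does; contradiction; map′; _×-dec_; _⊎-dec_; ¬?; _→-dec_)
open import Algebra.Properties.CommutativeMonoid.Sum +-0-commutativeMonoid
  using (sum; sum-cong-≗; ∑-distrib-+; ∑-comm)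
open import Algebra.Properties.Semiring.Sum +-*-semiring using (*-distribˡ-sum)

-- Finite sums and cardinalities of Boolean subsets.

sum-mono : ∀ {n} {f g : Vector ℕ n} → (∀ i → f i ≤ g i) → sum f ≤ sum g
sum-mono {zero}  f≤g = z≤n
sum-mono {suc n} f≤g = +-mono-≤ (f≤g zero) (sum-mono (f≤g ∘ suc))

sum-≤-const : ∀ {n} {f : Vector ℕ n} {u} → (∀ i → f i ≤ u) → sum f ≤ n * u
sum-≤-const {zero}  f≤u = z≤n
sum-≤-const {suc n} f≤u = +-mono-≤ (f≤u zero) (sum-≤-const (f≤u ∘ suc))

term≤sum : ∀ {n} (f : Vector ℕ n) i → f i ≤ sum f
term≤sum f zero    = m≤m+n _ _
term≤sum f (suc i) = ≤-trans (term≤sum (f ∘ suc) i) (m≤n+m _ (f zero))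

sum-+ : ∀ m {n} (f : Vector ℕ (m + n)) →
  sum f ≡ sum (λ i → f (i Fin.↑ˡ n)) + sum (λ j → f (m Fin.↑ʳ j))
sum-+ zero    f = refl
sum-+ (suc m) f = trans (cong (f zero +_) (sum-+ m (f ∘ suc))) (sym (+-assoc (f zero) _ _))

sum-combine : ∀ m {n} (f : Vector ℕ (m * n)) → sum f ≡ sum {m} (λ a → sum {n} (λ i → f (combine a i)))
sum-combine zero        f = refl
sum-combine (suc m) {n} f =
  trans (sum-+ n f) (cong (sum {n} (λ i → f (i Fin.↑ˡ (m * n))) +_)
    (sum-combine m {n} (λ p → f (n Fin.↑ʳ p))))

[_] : Bool → ℕ
[ b ] = if b then 1 else 0

card : ∀ {n} → (Fin n → Bool) → ℕ
card S = sum (λ i → [ S i ])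

infix 4 _⊆_
_⊆_ : ∀ {n} → (Fin n → Bool) → (Fin n → Bool) → Set
S ⊆ T = ∀ i → S i ≡ true → T i ≡ true

card-mono : ∀ {n} {S T : Fin n → Bool} → S ⊆ T → card S ≤ card T
card-mono {S = S} {T} S⊆T = sum-mono mono
  where
  mono : ∀ i → [ S i ] ≤ [ T i ]
  mono i with S i in Si
  ... | false = z≤n
  ... | true  rewrite S⊆T i Si = ≤-refl

card≤n : ∀ {n} (S : Fin n → Bool) → card S ≤ n
card≤n {n} S = subst (card S ≤_) (*-identityʳ n) (sum-≤-const (λ i → []≤1 (S i)))
  where
  []≤1 : ∀ b → [ b ] ≤ 1
  []≤1 false = z≤n
  []≤1 true  = s≤s z≤n

-- Derandomisation.

-- The method of conditional expectations: for independent fair bits h r, the right-hand side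
-- bounds the expectation of the left-hand side.
derandomise : ∀ {T} R (w : Fin T → ℕ) (e : Fin T → Fin R → Bool → ℕ) (g : Fin T → Fin R → ℕ) →
  (∀ t r → 3 ^ e t r false + 3 ^ e t r true ≤ 2 * 2 ^ g t r) →
  Σ[ h ∈ (Fin R → Bool) ]
    sum (λ t → w t * 3 ^ sum (λ r → e t r (h r))) ≤ sum (λ t → w t * 2 ^ sum (g t))
derandomise zero w e g fair = (λ ()) , ≤-refl
derandomise {T} (suc R) w e g fair = h , bound
  where
  -- All bits but the first are already replaced by their averaged bounds: `branch b` is the
  -- potential once the first bit is `b`, and `target` is the bound before it is chosen.
  W : Fin T → ℕ
  W t = w t * 2 ^ sum (λ r → g t (suc r))

  branch : Bool → ℕ
  branch b = sum (λ t → W t * 3 ^ e t zero b)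

  target : ℕ
  target = sum (λ t → W t * 2 ^ g t zero)

  branches : branch false + branch true ≤ 2 * target
  branches = begin
    branch false + branch true
      ≡⟨ ∑-distrib-+ (λ t → W t * 3 ^ e t zero false) (λ t → W t * 3 ^ e t zero true) ⟨
    sum (λ t → W t * 3 ^ e t zero false + W t * 3 ^ e t zero true)
      ≤⟨ sum-mono step ⟩
    sum (λ t → 2 * (W t * 2 ^ g t zero))
      ≡⟨ *-distribˡ-sum 2 (λ t → W t * 2 ^ g t zero) ⟨
    2 * target ∎
    where
    open ≤-Reasoning
    swap : ∀ a b → a * (2 * b) ≡ 2 * (a * b)
    swap = solve-∀
    step : ∀ t → W t * 3 ^ e t zero false + W t * 3 ^ e t zero true ≤ 2 * (W t * 2 ^ g t zero)
    step t = begin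
      W t * 3 ^ e t zero false + W t * 3 ^ e t zero true ≡⟨ *-distribˡ-+ (W t) _ _ ⟨
      W t * (3 ^ e t zero false + 3 ^ e t zero true)     ≤⟨ *-monoʳ-≤ (W t) (fair t zero) ⟩
      W t * (2 * 2 ^ g t zero)                           ≡⟨ swap (W t) _ ⟩
      2 * (W t * 2 ^ g t zero)                           ∎

  choose : Σ[ b ∈ Bool ] branch b ≤ target
  choose with branch false ≤? target
  ... | yes p = false , p
  -- The two branches add up to at most `2 * target`, so they cannot both exceed `target`.
  ... | no ¬p = true , ≮⇒≥ (λ q → <⇒≱ (+-mono-< (≰⇒> ¬p) q)
                 (≤-trans branches (≤-reflexive (cong (target +_) (+-identityʳ target)))))

  b : Bool
  b = proj₁ choose

  rest = derandomise R (λ t → w t * 3 ^ e t zero b) (λ t r → e t (suc r)) (λ t r → g t (suc r))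
           (λ t r → fair t (suc r))

  h : Fin (suc R) → Bool
  h zero    = b
  h (suc r) = proj₁ rest r

  regroup : ∀ a p s → a * p * s ≡ a * s * p
  regroup = solve-∀

  bound : sum (λ t → w t * 3 ^ sum (λ r → e t r (h r))) ≤ sum (λ t → w t * 2 ^ sum (g t))
  bound = begin
    sum (λ t → w t * 3 ^ sum (λ r → e t r (h r)))
      ≡⟨ sum-cong-≗ (λ t → trans (cong (w t *_) (^-distribˡ-+-* 3 (e t zero b) _))
           (sym (*-assoc (w t) _ _))) ⟩
    sum (λ t → w t * 3 ^ e t zero b * 3 ^ sum (λ r → e t (suc r) (proj₁ rest r)))
      ≤⟨ proj₂ rest ⟩
    sum (λ t → w t * 3 ^ e t zero b * 2 ^ sum (λ r → g t (suc r)))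
      ≡⟨ sum-cong-≗ (λ t → regroup (w t) _ _) ⟩
    branch b
      ≤⟨ proj₂ choose ⟩
    target
      ≡⟨ sum-cong-≗ (λ t → trans (regroup (w t) _ _) (trans (*-assoc (w t) _ _)
           (cong (w t *_) (sym (^-distribˡ-+-* 2 (g t zero) _))))) ⟩
    sum (λ t → w t * 2 ^ sum (g t)) ∎
    where open ≤-Reasoning

-- Configurations of points and their containers.

-- Points have their index as first and their key as second coordinate; the keys order the
-- points but may leave gaps, so no bijection has to be built before the final ranking.
Covered : ∀ {n K} → (Fin n → Fin K) → Fin n → Fin n → Set
Covered key i j = i Fin.< j × key i Fin.< key j ×
  (∀ ℓ → i Fin.< ℓ → ℓ Fin.< j → key i Fin.< key ℓ → key ℓ Fin.< key j → ⊥)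

Independent : ∀ {n K} → (Fin n → Fin K) → (Fin n → Bool) → Set
Independent key S = ∀ i j → S i ≡ true → S j ≡ true → ¬ Covered key i j

-- A bound on the size of independent sets alone could not be iterated: the next level takes a union
-- bound over the sets chosen in the columns, so these have to come from a short list. A container
-- need not be independent itself.
record Configuration (n κ u : ℕ) : Set where
  field
    {K}       : ℕ
    key       : Fin n → Fin K
    injective : Injective _≡_ _≡_ key
    container : Fin κ → Fin n → Bool
    small     : ∀ t → card (container t) ≤ u
    cover     : ∀ S → Independent key S → ∃[ t ] S ⊆ container t

-- Lexicographic order, reversal, and cuts of a single row.

combine-<⁻ : ∀ {m n} (a b : Fin m) (i j : Fin n) → combine a i Fin.< combine b j →
  a Fin.< b ⊎ (a ≡ b × i Fin.< j)
combine-<⁻ {n = n} a b i j lt with Fin.<-cmp a b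
... | tri< a<b _ _ = inj₁ a<b
... | tri≈ _ refl _ = inj₂ (refl , +-cancelˡ-< (n * toℕ a) _ _
        (subst₂ _<_ (Fin.toℕ-combine a i) (Fin.toℕ-combine a j) lt))
... | tri> _ _ b<a = contradiction lt (<-asym (Fin.combine-monoˡ-< j i b<a))

combine-monoʳ-< : ∀ {m n} (a : Fin m) {i j : Fin n} → i Fin.< j → combine a i Fin.< combine a j
combine-monoʳ-< {n = n} a {i} {j} i<j = subst₂ _<_
  (sym (Fin.toℕ-combine a i)) (sym (Fin.toℕ-combine a j)) (+-monoʳ-< (n * toℕ a) i<j)

opposite-anti : ∀ {n} (i j : Fin n) → i Fin.< j → opposite j Fin.< opposite i
opposite-anti {n} i j i<j = subst₂ _<_ (sym (Fin.opposite-prop j)) (sym (Fin.opposite-prop i))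
  (∸-monoʳ-< (s≤s i<j) (Fin.toℕ<n j))

opposite-anti⁻ : ∀ {n} (i j : Fin n) → opposite i Fin.< opposite j → j Fin.< i
opposite-anti⁻ i j lt = subst₂ Fin._<_ (Fin.opposite-involutive j) (Fin.opposite-involutive i)
  (opposite-anti (opposite i) (opposite j) lt)

opposite-injective : ∀ {n} {i j : Fin n} → opposite i ≡ opposite j → i ≡ j
opposite-injective {i = i} {j} eq = trans (sym (Fin.opposite-involutive i))
  (trans (cong opposite eq) (Fin.opposite-involutive j))

bit : Bool → Fin 2
bit false = 0F
bit true  = 1F

-- An independent subset of a row whose bits are h contains no low point (bit false) to the
-- left of a high one (bit true); hence some cut j has all its low points at or after j and
-- all its high points before j.
threshold : ∀ {m} (h S : Fin m → Bool) →
  (∀ a b → a Fin.< b → h a ≡ false → h b ≡ true → S a ≡ true → S b ≡ true → ⊥) →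
  Σ[ j ∈ Fin (suc m) ] ∀ a → S a ≡ true →
    (h a ≡ false → toℕ j ≤ toℕ a) × (h a ≡ true → toℕ a < toℕ j)
threshold {zero}  h S free = zero , λ ()
threshold {suc m} h S free with h zero in h0 | S zero in S0
-- A low point of `S` in the first position excludes every high point of `S`, so the cut goes before
-- everything. In the other cases the first position can lie before the cut found for the tail,
-- which shifts by one.
... | false | true = zero , λ a Sa → (λ _ → z≤n) , λ ha → ⊥-elim (high a ha Sa)
  where
  high : ∀ a → h a ≡ true → S a ≡ true → ⊥
  high zero    ha Sa with () ← trans (sym h0) ha
  high (suc a) ha Sa = free zero (suc a) z<s h0 ha S0 Sa
... | false | false = suc j , extend
  where
  tail = threshold (h ∘ suc) (S ∘ suc) (λ a b a<b → free (suc a) (suc b) (s<s a<b))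
  j = proj₁ tail
  extend : ∀ a → S a ≡ true → (h a ≡ false → toℕ (suc j) ≤ toℕ a) × (h a ≡ true → toℕ a < toℕ (suc j))
  extend zero    Sa with () ← trans (sym S0) Sa
  extend (suc a) Sa = (λ ha → s≤s (proj₁ (proj₂ tail a Sa) ha)) , (λ ha → s≤s (proj₂ (proj₂ tail a Sa) ha))
... | true | _ = suc j , extend
  where
  tail = threshold (h ∘ suc) (S ∘ suc) (λ a b a<b → free (suc a) (suc b) (s<s a<b))
  j = proj₁ tail
  extend : ∀ a → S a ≡ true → (h a ≡ false → toℕ (suc j) ≤ toℕ a) × (h a ≡ true → toℕ a < toℕ (suc j))
  extend zero    Sa = (λ ha → contradiction (trans (sym h0) ha) λ ()) , (λ _ → z<s)
  extend (suc a) Sa = (λ ha → s≤s (proj₁ (proj₂ tail a Sa) ha)) , (λ ha → s≤s (proj₂ (proj₂ tail a Sa) ha))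

allowed : ∀ {m} → Fin (suc m) → Fin m → Bool → Bool
allowed j a false = not (toℕ a <ᵇ toℕ j)
allowed j a true  = toℕ a <ᵇ toℕ j

allowed-intro : ∀ {m} (j : Fin (suc m)) (a : Fin m) b →
  (b ≡ false → toℕ j ≤ toℕ a) → (b ≡ true → toℕ a < toℕ j) → allowed j a b ≡ true
allowed-intro j a true  low high = Equivalence.to T-≡ (<⇒<ᵇ (high refl))
allowed-intro j a false low high with toℕ a <ᵇ toℕ j in eq
... | true  = contradiction (low refl) (<⇒≱ (<ᵇ⇒< _ _ (Equivalence.from T-≡ eq)))
... | false = refl

-- Exactly one of the two bits lets a point survive a given cut. So a point of the container gives
-- `3 + 1 = 2 * 2`, any other point `1 + 1 = 2 * 1`: equality in both cases.
allowed-fair : ∀ {m} (j : Fin (suc m)) (a : Fin m) c →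
  3 ^ [ c ∧ allowed j a false ] + 3 ^ [ c ∧ allowed j a true ] ≤ 2 * 2 ^ [ c ]
allowed-fair j a false = ≤-refl
allowed-fair j a true with toℕ a <ᵇ toℕ j
... | false = ≤-refl
... | true  = ≤-refl

^-cancelʳ-≤ : ∀ m {a b} → 1 < m → m ^ a ≤ m ^ b → a ≤ b
^-cancelʳ-≤ m 1<m le = ≮⇒≥ (λ b<a → <⇒≱ (^-monoʳ-< m 1<m b<a) le)

-- Geometry of one amplification step.

module Step (m : ℕ) {n κ u : ℕ} (P : Configuration n κ u) (h : Fin m → Fin n → Bool) where
  open Configuration P

  -- The index of a point orders by column, then by i; its key by row, then by bit, then by
  -- decreasing column.
  rowKey : Fin n → Fin m → Fin (K * (2 * m))
  rowKey i a = combine (key i) (combine (bit (h a i)) (opposite a))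

  key′ : Fin (m * n) → Fin (K * (2 * m))
  key′ p = let a , i = remQuot {m} n p in rowKey i a

  key′-combine : ∀ a i → key′ (combine a i) ≡ rowKey i a
  key′-combine a i = cong (λ (a , i) → rowKey i a) (Fin.remQuot-combine a i)

  injective′ : Injective _≡_ _≡_ key′
  injective′ {p} {p′} eq
    with a , i , refl ← Fin.combine-surjective {m} {n} p
       | b , j , refl ← Fin.combine-surjective {m} {n} p′
    with k≡ , r≡ ← Fin.combine-injective _ _ _ _
                     (trans (sym (key′-combine a i)) (trans eq (key′-combine b j)))
    = cong₂ combine (opposite-injective (proj₂ (Fin.combine-injective
                      (bit (h a i)) (opposite a) (bit (h b j)) (opposite b) r≡)))
                    (injective k≡)

  key′-<⁻ : ∀ a i b j → key′ (combine a i) Fin.< key′ (combine b j) →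
    key i Fin.< key j ⊎ (i ≡ j × combine (bit (h a i)) (opposite a) Fin.< combine (bit (h b j)) (opposite b))
  key′-<⁻ a i b j lt
    with combine-<⁻ (key i) (key j) _ _ (subst₂ Fin._<_ (key′-combine a i) (key′-combine b j) lt)
  ... | inj₁ k<k′       = inj₁ k<k′
  ... | inj₂ (k≡k′ , r) = inj₂ (injective k≡k′ , r)

  -- An index between two points of column `a` belongs to the same column, and there distinct points
  -- lie in distinct rows. A blocking point would therefore block already in the old configuration.
  column-covered : ∀ a {i j} → Covered key i j → Covered key′ (combine a i) (combine a j)
  column-covered a {i} {j} (i<j , ki<kj , empty) =
    combine-monoʳ-< a i<j ,
    subst₂ Fin._<_ (sym (key′-combine a i)) (sym (key′-combine a j)) (Fin.combine-monoˡ-< _ _ ki<kj) ,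
    empty′
    where
    empty′ : ∀ p → combine a i Fin.< p → p Fin.< combine a j →
      key′ (combine a i) Fin.< key′ p → key′ p Fin.< key′ (combine a j) → ⊥
    empty′ p x₁ x₂ y₁ y₂ with b , ℓ , refl ← Fin.combine-surjective {m} {n} p
      with combine-<⁻ a b i ℓ x₁ | combine-<⁻ b a ℓ j x₂
    ... | inj₁ a<b | inj₁ b<a = <-asym a<b b<a
    ... | inj₁ a<b | inj₂ (refl , _) = <-irrefl refl a<b
    ... | inj₂ (refl , _) | inj₁ b<a = <-irrefl refl b<a
    ... | inj₂ (refl , i<ℓ) | inj₂ (_ , ℓ<j) with key′-<⁻ a i b ℓ y₁ | key′-<⁻ b ℓ a j y₂
    ...   | inj₁ y₁′ | inj₁ y₂′ = empty ℓ i<ℓ ℓ<j y₁′ y₂′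
    ...   | inj₂ (refl , _) | _ = <-irrefl refl i<ℓ
    ...   | inj₁ _ | inj₂ (refl , _) = <-irrefl refl ℓ<j

  -- A blocking point has its key, hence itself, in row `i`, and its column strictly between `a` and
  -- `b`. Since both classes decrease, a low point there is below the one in column `a`, and a high
  -- point is above the one in column `b`.
  row-covered : ∀ i {a b} → a Fin.< b → h a i ≡ false → h b i ≡ true →
    Covered key′ (combine a i) (combine b i)
  row-covered i {a} {b} a<b ha hb =
    Fin.combine-monoˡ-< i i a<b ,
    subst₂ Fin._<_ (sym (key′-combine a i)) (sym (key′-combine b i))
      (combine-monoʳ-< (key i) (Fin.combine-monoˡ-< _ _ bits)) ,
    empty′
    where
    bits : bit (h a i) Fin.< bit (h b i)
    bits rewrite ha | hb = z<s

    between : ∀ c → a Fin.< c → c Fin.< b →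
      combine (bit (h a i)) (opposite a) Fin.< combine (bit (h c i)) (opposite c) →
      combine (bit (h c i)) (opposite c) Fin.< combine (bit (h b i)) (opposite b) → ⊥
    between c a<c c<b y₁ y₂ rewrite ha | hb with h c i
    ... | false with combine-<⁻ {2} 0F 0F (opposite a) (opposite c) y₁
    ...   | inj₂ (_ , lt) = <-asym a<c (opposite-anti⁻ a c lt)
    between c a<c c<b y₁ y₂ | true with combine-<⁻ {2} 1F 1F (opposite c) (opposite b) y₂
    ...   | inj₁ (s≤s ())
    ...   | inj₂ (_ , lt) = <-asym c<b (opposite-anti⁻ c b lt)

    empty′ : ∀ p → combine a i Fin.< p → p Fin.< combine b i →
      key′ (combine a i) Fin.< key′ p → key′ p Fin.< key′ (combine b i) → ⊥
    empty′ p x₁ x₂ y₁ y₂ with c , ℓ , refl ← Fin.combine-surjective {m} {n} p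
      with key′-<⁻ a i c ℓ y₁ | key′-<⁻ c ℓ b i y₂
    ... | inj₁ ki<kℓ | inj₁ kℓ<ki = <-asym ki<kℓ kℓ<ki
    ... | inj₁ ki<kℓ | inj₂ (refl , _) = <-irrefl refl ki<kℓ
    ... | inj₂ (refl , _) | inj₁ kℓ<ki = <-irrefl refl kℓ<ki
    ... | inj₂ (refl , r₁) | inj₂ (_ , r₂) with combine-<⁻ a c i ℓ x₁ | combine-<⁻ c b ℓ i x₂
    ...   | inj₁ a<c | inj₁ c<b = between c a<c c<b r₁ r₂
    ...   | inj₁ _ | inj₂ (_ , i<i) = <-irrefl refl i<i
    ...   | inj₂ (_ , i<i) | _ = <-irrefl refl i<i

  rows-and-columns : ∀ S → Independent key′ S →
    Σ[ c ∈ (Fin m → Fin κ) ] Σ[ j ∈ (Fin n → Fin (suc m)) ]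
      (∀ a i → S (combine a i) ≡ true → container (c a) i ≡ true × allowed (j i) a (h a i) ≡ true)
  rows-and-columns S indep = proj₁ ∘ column , proj₁ ∘ row , λ a i Sp →
    proj₂ (column a) i Sp ,
    allowed-intro (proj₁ (row i)) a (h a i) (proj₁ (proj₂ (row i) a Sp)) (proj₂ (proj₂ (row i) a Sp))
    where
    column : ∀ a → ∃[ t ] (λ i → S (combine a i)) ⊆ container t
    column a = cover (λ i → S (combine a i)) (λ i j Si Sj c → indep _ _ Si Sj (column-covered a c))

    row : ∀ i → Σ[ j ∈ Fin (suc m) ] ∀ a → S (combine a i) ≡ true →
      (h a i ≡ false → toℕ j ≤ toℕ a) × (h a i ≡ true → toℕ a < toℕ j)
    row i = threshold (λ a → h a i) (λ a → S (combine a i))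
      (λ a b a<b ha hb Sa Sb → indep _ _ Sa Sb (row-covered i a<b ha hb))

-- Counting the choices, and bits that are good for all of them.

module Choices (m : ℕ) {n κ : ℕ} (C : Fin κ → Fin n → Bool) where
  -- One of `κ` containers for each of the `m` columns and one of `m + 1` cuts for each of the `n`
  -- rows. The list is fixed before the bits are, so that one assignment of bits can serve all
  -- choices at once.
  κ′ : ℕ
  κ′ = κ ^ m * suc m ^ n

  column : Fin κ′ → Fin m → Fin κ
  column t = finToFun (proj₁ (remQuot {κ ^ m} (suc m ^ n) t))

  cut : Fin κ′ → Fin n → Fin (suc m)
  cut t = finToFun (proj₂ (remQuot {κ ^ m} (suc m ^ n) t))

  choice : ∀ c j → ∃[ t ] (∀ a → column t a ≡ c a) × (∀ i → cut t i ≡ j i)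
  choice c j = combine (funToFin c) (funToFin j) ,
    (λ a → trans (cong (λ (c , _) → finToFun c a) (Fin.remQuot-combine {κ ^ m} _ _))
                 (Fin.finToFun-funToFin c a)) ,
    (λ i → trans (cong (λ (_ , j) → finToFun j i) (Fin.remQuot-combine {κ ^ m} _ _))
                 (Fin.finToFun-funToFin j i))

  insideAt : Fin κ′ → Fin m × Fin n → Bool → Bool
  insideAt t (a , i) b = C (column t a) i ∧ allowed (cut t i) a b

  inside : Fin κ′ → Fin (m * n) → Bool → Bool
  inside t p = insideAt t (remQuot {m} n p)

  weightAt : Fin κ′ → Fin m × Fin n → ℕ
  weightAt t (a , i) = [ C (column t a) i ]

  weight : Fin κ′ → Fin (m * n) → ℕ
  weight t p = weightAt t (remQuot {m} n p)

  fair : ∀ t p → 3 ^ [ inside t p false ] + 3 ^ [ inside t p true ] ≤ 2 * 2 ^ weight t p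
  fair t p = allowed-fair (cut t i) a (C (column t a) i)
    where
    a = proj₁ (remQuot {m} n p)
    i = proj₂ (remQuot {m} n p)

  weight-bound : ∀ {u} → (∀ t → card (C t) ≤ u) → ∀ t → sum (weight t) ≤ m * u
  weight-bound {u} small t = begin
    sum (weight t)
      ≡⟨ sum-combine m (weight t) ⟩
    sum {m} (λ a → sum {n} (λ i → weight t (combine a i)))
      ≡⟨ sum-cong-≗ {m} (λ a → sum-cong-≗ {n} (λ i → cong (weightAt t) (Fin.remQuot-combine {m} {n} a i))) ⟩
    sum {m} (λ a → card (C (column t a)))
      ≤⟨ sum-≤-const (λ a → small (column t a)) ⟩
    m * u ∎
    where open ≤-Reasoning

  -- The initial potential is at most `κ′ * 2 ^ (m * u)`, as only points of the chosen containers
  -- carry weight. A choice keeping more than `u′` points would alone contribute more than `3 ^ u′`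
  -- to the final one.
  random : ∀ {u u′} → (∀ t → card (C t) ≤ u) → κ′ * 2 ^ (m * u) ≤ 3 ^ u′ →
    Σ[ h ∈ (Fin (m * n) → Bool) ] ∀ t → card (λ p → inside t p (h p)) ≤ u′
  random {u} {u′} small enough = h , λ t → ^-cancelʳ-≤ 3 {card (λ p → inside t p (h p))} {u′}
    (s≤s (s≤s z≤n)) (begin
    3 ^ card (λ p → inside t p (h p))
      ≡⟨ *-identityˡ _ ⟨
    1 * 3 ^ card (λ p → inside t p (h p))
      ≤⟨ term≤sum (λ t → 1 * 3 ^ card (λ p → inside t p (h p))) t ⟩
    sum (λ t → 1 * 3 ^ card (λ p → inside t p (h p)))
      ≤⟨ proj₂ bits ⟩
    sum (λ t → 1 * 2 ^ sum (weight t))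
      ≤⟨ sum-≤-const (λ t → ≤-trans (≤-reflexive (*-identityˡ _)) (^-monoʳ-≤ 2 (weight-bound small t))) ⟩
    κ′ * 2 ^ (m * u)
      ≤⟨ enough ⟩
    3 ^ u′ ∎)
    where
    open ≤-Reasoning
    bits = derandomise (m * n) (λ _ → 1) (λ t p b → [ inside t p b ]) weight fair
    h = proj₁ bits

amplify : ∀ m {n κ u u′} → Configuration n κ u → κ ^ m * suc m ^ n * 2 ^ (m * u) ≤ 3 ^ u′ →
  Configuration (m * n) (κ ^ m * suc m ^ n) u′
amplify m {n} {u′ = u′} P enough = extend (random small enough)
  where
  open Configuration P
  open Choices m container

  extend : (Σ[ h ∈ (Fin (m * n) → Bool) ] ∀ t → card (λ p → inside t p (h p)) ≤ u′) →
    Configuration (m * n) κ′ u′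
  extend (h , small′) = record
    { key       = key′
    ; injective = injective′
    ; container = λ t p → inside t p (h p)
    ; small     = small′
    ; cover     = cover′
    }
    where
    open Step m P (λ a i → h (combine a i))
    open ≡-Reasoning

    cover′ : ∀ S → Independent key′ S → ∃[ t ] S ⊆ (λ p → inside t p (h p))
    cover′ S indep with c , j , S⊆ ← rows-and-columns S indep
      with t , column≡ , cut≡ ← choice c j = t , S⊆t
      where
      S⊆t : S ⊆ (λ p → inside t p (h p))
      S⊆t p Sp with a , i , refl ← Fin.combine-surjective {m} {n} p = begin
        inside t (combine a i) (h (combine a i))
          ≡⟨ cong (λ ai → insideAt t ai (h (combine a i))) (Fin.remQuot-combine {m} {n} a i) ⟩
        container (column t a) i ∧ allowed (cut t i) a (h (combine a i))
          ≡⟨ cong₂ (λ c j → container c i ∧ allowed j a (h (combine a i))) (column≡ a) (cut≡ i) ⟩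
        container (c a) i ∧ allowed (j i) a (h (combine a i))
          ≡⟨ cong₂ _∧_ (proj₁ (S⊆ a i Sp)) (proj₂ (S⊆ a i Sp)) ⟩
        true ∎

-- Copies of a configuration along the diagonal, followed by `r` further points.

module Blocks (q r : ℕ) {n κ u : ℕ} (P : Configuration n κ u) where
  open Configuration P

  L : ℕ
  L = q * K + r

  inBlock : Fin q → Fin n → Fin (q * n + r)
  inBlock b i = combine b i Fin.↑ˡ r

  placeˡ : Fin (q * n) → Fin L
  placeˡ p = combine (proj₁ (remQuot {q} n p)) (key (proj₂ (remQuot {q} n p))) Fin.↑ˡ r

  place : Fin (q * n) ⊎ Fin r → Fin L
  place (inj₁ p) = placeˡ p
  place (inj₂ k) = (q * K) Fin.↑ʳ k

  keys : Fin (q * n + r) → Fin L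
  keys p = place (Fin.splitAt (q * n) p)

  data View : Fin (q * n + r) → Set where
    block : ∀ b i → View (inBlock b i)
    rest  : ∀ k → View ((q * n) Fin.↑ʳ k)

  view : ∀ p → View p
  view p with Fin.splitAt (q * n) p in eq
  ... | inj₁ p′ with refl ← Fin.splitAt⁻¹-↑ˡ {m = q * n} eq
              with b , i , refl ← Fin.combine-surjective {q} {n} p′ = block b i
  ... | inj₂ k with refl ← Fin.splitAt⁻¹-↑ʳ {m = q * n} eq = rest k

  keys-block : ∀ b i → keys (inBlock b i) ≡ combine b (key i) Fin.↑ˡ r
  keys-block b i = trans (cong place (Fin.splitAt-↑ˡ (q * n) (combine b i) r))
    (cong (λ (b , i) → combine b (key i) Fin.↑ˡ r) (Fin.remQuot-combine {q} {n} b i))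

  keys-rest : ∀ k → keys ((q * n) Fin.↑ʳ k) ≡ (q * K) Fin.↑ʳ k
  keys-rest k = cong place (Fin.splitAt-↑ʳ (q * n) r k)

  ↑ˡ≢↑ʳ : ∀ {m} (i : Fin m) (k : Fin r) → i Fin.↑ˡ r ≢ m Fin.↑ʳ k
  ↑ˡ≢↑ʳ {m} i k eq with () ←
    trans (sym (Fin.splitAt-↑ˡ m i r)) (trans (cong (Fin.splitAt m) eq) (Fin.splitAt-↑ʳ m r k))

  keys-injective : Injective _≡_ _≡_ keys
  keys-injective {p} {p′} eq with view p | view p′
  ... | block b i | block c j
    with b≡c , ki≡kj ← Fin.combine-injective b (key i) c (key j)
           (Fin.↑ˡ-injective r _ _ (trans (sym (keys-block b i)) (trans eq (keys-block c j))))
    = cong₂ inBlock b≡c (injective ki≡kj)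
  ... | block b i | rest k =
    contradiction (trans (sym (keys-block b i)) (trans eq (keys-rest k))) (↑ˡ≢↑ʳ _ k)
  ... | rest k | block b i =
    contradiction (trans (sym (keys-block b i)) (trans (sym eq) (keys-rest k))) (↑ˡ≢↑ʳ _ k)
  ... | rest k | rest l =
    cong ((q * n) Fin.↑ʳ_) (Fin.↑ʳ-injective (q * K) k l (trans (sym (keys-rest k)) (trans eq (keys-rest l))))

  ↑ˡ-< : ∀ {m} {i j : Fin m} → i Fin.< j → i Fin.↑ˡ r Fin.< j Fin.↑ˡ r
  ↑ˡ-< {i = i} {j} = subst₂ _<_ (sym (Fin.toℕ-↑ˡ i r)) (sym (Fin.toℕ-↑ˡ j r))

  ↑ˡ-<⁻ : ∀ {m} {i j : Fin m} → i Fin.↑ˡ r Fin.< j Fin.↑ˡ r → i Fin.< j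
  ↑ˡ-<⁻ {i = i} {j} = subst₂ _<_ (Fin.toℕ-↑ˡ i r) (Fin.toℕ-↑ˡ j r)

  -- The index alone rules out blocking points in other blocks and among the last `r` points; inside
  -- a block both orders are those of the original configuration.
  block-covered : ∀ b {i j} → Covered key i j → Covered keys (inBlock b i) (inBlock b j)
  block-covered b {i} {j} (i<j , ki<kj , empty) =
    ↑ˡ-< (combine-monoʳ-< b i<j) ,
    subst₂ Fin._<_ (sym (keys-block b i)) (sym (keys-block b j)) (↑ˡ-< (combine-monoʳ-< b ki<kj)) ,
    empty′
    where
    empty′ : ∀ p → inBlock b i Fin.< p → p Fin.< inBlock b j →
      keys (inBlock b i) Fin.< keys p → keys p Fin.< keys (inBlock b j) → ⊥
    empty′ p x₁ x₂ y₁ y₂ with view p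
    ... | rest k = <⇒≱ (Fin.toℕ<n (combine b j))
      (≤-trans (m≤m+n (q * n) (toℕ k)) (<⇒≤
        (subst₂ _<_ (Fin.toℕ-↑ʳ (q * n) k) (Fin.toℕ-↑ˡ (combine b j) r) x₂)))
    ... | block c ℓ with combine-<⁻ b c i ℓ (↑ˡ-<⁻ x₁) | combine-<⁻ c b ℓ j (↑ˡ-<⁻ x₂)
    ...   | inj₁ b<c | inj₁ c<b = <-asym b<c c<b
    ...   | inj₁ b<c | inj₂ (refl , _) = <-irrefl refl b<c
    ...   | inj₂ (refl , _) | inj₁ c<b = <-irrefl refl c<b
    ...   | inj₂ (refl , i<ℓ) | inj₂ (_ , ℓ<j)
      with combine-<⁻ b b (key i) (key ℓ) (↑ˡ-<⁻ (subst₂ Fin._<_ (keys-block b i) (keys-block b ℓ) y₁))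
         | combine-<⁻ b b (key ℓ) (key j) (↑ˡ-<⁻ (subst₂ Fin._<_ (keys-block b ℓ) (keys-block b j) y₂))
    ...     | inj₁ b<b | _ = <-irrefl refl b<b
    ...     | inj₂ _ | inj₁ b<b = <-irrefl refl b<b
    ...     | inj₂ (_ , y₁′) | inj₂ (_ , y₂′) = empty ℓ i<ℓ ℓ<j y₁′ y₂′

  card-blocks : ∀ S → Independent keys S → card S ≤ q * u + r
  card-blocks S indep = begin
    card S
      ≡⟨ sum-+ (q * n) (λ p → [ S p ]) ⟩
    card (λ p → S (p Fin.↑ˡ r)) + card (λ k → S ((q * n) Fin.↑ʳ k))
      ≤⟨ +-monoʳ-≤ _ (card≤n (λ k → S ((q * n) Fin.↑ʳ k))) ⟩
    card (λ p → S (p Fin.↑ˡ r)) + r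
      ≡⟨ cong (_+ r) (sum-combine q {n} (λ p → [ S (p Fin.↑ˡ r) ])) ⟩
    sum {q} (λ b → card (λ i → S (inBlock b i))) + r
      ≤⟨ +-monoˡ-≤ r (sum-≤-const block-card) ⟩
    q * u + r ∎
    where
    open ≤-Reasoning
    block-card : ∀ b → card (λ i → S (inBlock b i)) ≤ u
    block-card b with t , S⊆ ← cover (λ i → S (inBlock b i))
                                 (λ i j Si Sj c → indep _ _ Si Sj (block-covered b c))
      = ≤-trans (card-mono S⊆) (small t)

-- From keys with gaps to a permutation.

card-mono-< : ∀ {n} {S T : Fin n → Bool} i → S ⊆ T → S i ≡ false → T i ≡ true → card S < card T
card-mono-< {S = S} {T} zero S⊆T Si Ti rewrite Si | Ti = s≤s (card-mono (λ j → S⊆T (suc j)))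
card-mono-< {S = S} {T} (suc i) S⊆T Si Ti with S zero in S0
... | false = <-≤-trans (card-mono-< i (λ j → S⊆T (suc j)) Si Ti) (m≤n+m _ _)
... | true rewrite S⊆T zero S0 = s<s (card-mono-< i (λ j → S⊆T (suc j)) Si Ti)

injective⇒permutation : ∀ {n} (f : Fin n → Fin n) → Injective _≡_ _≡_ f →
  Σ[ π ∈ Permutation′ n ] ∀ i → π ⟨$⟩ʳ i ≡ f i
injective⇒permutation {n} f inj =
  permutation f (proj₁ ∘ surjective f inj) (proj₂ ∘ surjective f inj)
    (λ i → inj (proj₂ (surjective f inj (f i)))) , λ i → refl
  where
  surjective : ∀ {n} (f : Fin n → Fin n) → Injective _≡_ _≡_ f → ∀ y → ∃[ x ] f x ≡ y
  surjective {suc n} f inj y with Fin.any? (λ x → f x Fin.≟ y)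
  ... | yes x = x
  -- Punching a missed value out of the codomain would leave an injection into a smaller set.
  ... | no ¬x = contradiction (Fin.injective⇒≤ squeezed-injective) 1+n≰n
    where
    y≢ : ∀ x → y ≢ f x
    y≢ x y≡ = ¬x (x , sym y≡)
    squeezed : Fin (suc n) → Fin n
    squeezed x = punchOut (y≢ x)
    squeezed-injective : Injective _≡_ _≡_ squeezed
    squeezed-injective {x} {x′} eq = inj (Fin.punchOut-injective (y≢ x) (y≢ x′) eq)

module Ranking {n K : ℕ} (key : Fin n → Fin K) (injective : Injective _≡_ _≡_ key) where
  below : Fin n → Fin n → Bool
  below i j = toℕ (key j) <ᵇ toℕ (key i)

  below-intro : ∀ {i j} → key j Fin.< key i → below i j ≡ true
  below-intro lt = Equivalence.to T-≡ (<⇒<ᵇ lt)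

  below-elim : ∀ {i j} → below i j ≡ true → key j Fin.< key i
  below-elim eq = <ᵇ⇒< _ _ (Equivalence.from T-≡ eq)

  below-irrefl : ∀ i → below i i ≡ false
  below-irrefl i with below i i in eq
  ... | false = refl
  ... | true  = contradiction (below-elim {i} {i} eq) (<-irrefl refl)

  rank<n : ∀ i → card (below i) < n
  rank<n i = <-≤-trans (card-mono-< {T = λ _ → true} i (λ _ _ → refl) (below-irrefl i) refl)
                       (card≤n (λ _ → true))

  -- Counting the smaller keys closes the gaps between keys and keeps their order, which is all that
  -- coverings depend on.
  rank : Fin n → Fin n
  rank i = fromℕ< (rank<n i)

  rank-mono : ∀ {i j} → key i Fin.< key j → rank i Fin.< rank j
  rank-mono {i} {j} lt = subst₂ _<_ (sym (Fin.toℕ-fromℕ< (rank<n i))) (sym (Fin.toℕ-fromℕ< (rank<n j)))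
    (card-mono-< i (λ k lt′ → below-intro {j} {k} (<-trans (below-elim {i} {k} lt′) lt))
      (below-irrefl i) (below-intro {j} {i} lt))

  rank-cancel : ∀ {i j} → rank i Fin.< rank j → key i Fin.< key j
  rank-cancel {i} {j} lt with Fin.<-cmp (key i) (key j)
  ... | tri< k<k′ _ _ = k<k′
  ... | tri≈ _ k≡k′ _ with refl ← injective k≡k′ = contradiction lt (<-irrefl refl)
  ... | tri> _ _ k>k′ = contradiction lt (<-asym (rank-mono k>k′))

  rank-injective : Injective _≡_ _≡_ rank
  rank-injective {i} {j} eq with Fin.<-cmp (key i) (key j)
  ... | tri< lt _ _ = contradiction (cong toℕ eq) (<⇒≢ (rank-mono lt))
  ... | tri≈ _ k≡k′ _ = injective k≡k′
  ... | tri> _ _ gt = contradiction (cong toℕ (sym eq)) (<⇒≢ (rank-mono gt))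

  ranking : Permutation′ n
  ranking = proj₁ (injective⇒permutation rank rank-injective)

  covered⇒covers : ∀ {i j} → Covered key i j → Covers ranking i j
  covered⇒covers (i<j , ki<kj , empty) = i<j , rank-mono ki<kj , λ (ℓ , i<ℓ , ℓ<j , y₁ , y₂) →
    empty ℓ i<ℓ ℓ<j (rank-cancel y₁) (rank-cancel y₂)

-- Existence of the independence and chromatic numbers, by finite search.

∣∣≡card : ∀ {n} (S : Subset n) → ∣ S ∣ ≡ card (lookup S)
∣∣≡card []          = refl
∣∣≡card (true ∷ S)  = cong suc (∣∣≡card S)
∣∣≡card (false ∷ S) = ∣∣≡card S

maximum : ∀ {P : ℕ → Set} → (∀ k → Dec (P k)) → ∀ b → (∀ k → P k → k ≤ b) → ∃ P →
  ∃[ k ] P k × (∀ j → P j → j ≤ k)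
maximum P? b bounded (k , Pk) with P? b
... | yes Pb = b , Pb , bounded
maximum {P} P? zero bounded (k , Pk) | no ¬Pb = contradiction (subst P (n≤0⇒n≡0 (bounded k Pk)) Pk) ¬Pb
maximum {P} P? (suc b) bounded ∃P | no ¬Pb =
  maximum P? b (λ k Pk → s≤s⁻¹ (≤∧≢⇒< (bounded k Pk) (λ k≡ → ¬Pb (subst P k≡ Pk)))) ∃P

minimum : ∀ {P : ℕ → Set} → (∀ k → Dec (P k)) → ∀ b → P b → ∃[ k ] P k × (∀ j → P j → k ≤ j)
minimum P? b Pb with P? zero
... | yes P0 = zero , P0 , λ _ _ → z≤n
minimum P? zero Pb | no ¬P0 = contradiction Pb ¬P0
minimum {P} P? (suc b) Pb | no ¬P0 with k , Pk , least ← minimum (P? ∘ suc) b Pb = suc k , Pk , least′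
  where
  least′ : ∀ j → P j → suc k ≤ j
  least′ zero    P0 = contradiction P0 ¬P0
  least′ (suc j) Pj = s≤s (least j Pj)

covers? : ∀ {n} (π : Permutation′ n) i j → Dec (Covers π i j)
covers? π i j = (i Fin.<? j) ×-dec (π ⟨$⟩ʳ i Fin.<? π ⟨$⟩ʳ j) ×-dec
  ¬? (Fin.any? λ ℓ → (i Fin.<? ℓ) ×-dec (ℓ Fin.<? j) ×-dec
        (π ⟨$⟩ʳ i Fin.<? π ⟨$⟩ʳ ℓ) ×-dec (π ⟨$⟩ʳ ℓ Fin.<? π ⟨$⟩ʳ j))

module Extremal {n : ℕ} (G : Graph n) (adj? : ∀ i j → Dec (Adj G i j)) where
  independent? : ∀ S → Dec (IsIndependent G S)
  independent? S = Fin.all? λ i → Fin.all? λ j →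
    (i Subset.∈? S) →-dec ((j Subset.∈? S) →-dec ¬? (adj? i j))

  independenceNumber : ∃[ α ] IsIndependenceNumber G α
  independenceNumber with α , realised , largest ← maximum
    (λ k → Subset.anySubset? (λ S → independent? S ×-dec (∣ S ∣ ≟ k))) n
    (λ k (S , _ , size) → subst (_≤ n) size (Subset.∣p∣≤n S))
    (∣ Subset.⊥ {n} ∣ , Subset.⊥ , (λ i j i∈ → contradiction i∈ Subset.∉⊥) , refl)
    = α , realised , λ S indep → largest ∣ S ∣ (S , indep , refl)

  colourable? : ∀ k → Dec (Colourable G k)
  colourable? k = map′ (λ (t , proper) → finToFun t , proper)
    (λ (f , proper) → funToFin f , λ i j i~j →
      subst₂ _≢_ (sym (Fin.finToFun-funToFin f i)) (sym (Fin.finToFun-funToFin f j)) (proper i j i~j))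
    (Fin.any? λ t → Fin.all? λ i → Fin.all? λ j → adj? i j →-dec ¬? (finToFun {k} {n} t i Fin.≟ finToFun t j))

  chromaticNumber : ∃[ χ ] IsChromaticNumber G χ
  chromaticNumber = minimum colourable? n
    (id , λ i j i~j i≡j → Graph.irrefl G (subst (Adj G i) (sym i≡j) i~j))

  module _ {α χ} (isα : IsIndependenceNumber G α) (isχ : IsChromaticNumber G χ) where
    colour : Fin n → Fin χ
    colour = proj₁ (proj₁ isχ)

    class : Fin χ → Fin n → Bool
    class c i = does (colour i Fin.≟ c)

    -- Each colour class of an optimal colouring is independent; the points are counted by colour.
    order≤χ*α : n ≤ χ * α
    order≤χ*α = begin
      n                                        ≡⟨ all ⟩
      sum {n} (λ i → 1)                        ≤⟨ sum-mono counted ⟩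
      sum {n} (λ i → sum {χ} (λ c → [ class c i ])) ≡⟨ ∑-comm (λ i c → [ class c i ]) ⟩
      sum {χ} (λ c → card (class c))           ≤⟨ sum-≤-const class-small ⟩
      χ * α                                    ∎
      where
      open ≤-Reasoning
      all : ∀ {n} → n ≡ sum {n} (λ i → 1)
      all {zero}  = refl
      all {suc n} = cong suc all

      counted : ∀ i → 1 ≤ sum {χ} (λ c → [ class c i ])
      counted i = ≤-trans own (term≤sum (λ c → [ class c i ]) (colour i))
        where
        own : 1 ≤ [ class (colour i) i ]
        own with colour i Fin.≟ colour i
        ... | yes _ = ≤-refl
        ... | no ≢  = contradiction refl ≢

      class-elim : ∀ c i → i Subset.∈ tabulate (class c) → colour i ≡ c
      class-elim c i i∈ with trans (sym (lookup∘tabulate (class c) i)) ([]=⇒lookup i∈)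
      ... | eq with colour i Fin.≟ c
      ...   | yes p = p

      class-small : ∀ c → card (class c) ≤ α
      class-small c = subst (_≤ α)
        (trans (∣∣≡card (tabulate (class c))) (sum-cong-≗ (λ i → cong [_] (lookup∘tabulate (class c) i))))
        (proj₂ isα (tabulate (class c)) λ i j i∈ j∈ i~j →
          proj₂ (proj₁ isχ) i j i~j (trans (class-elim c i i∈) (sym (class-elim c j j∈))))

hasse-graph : ∀ q r {n κ u} → Configuration n κ u →
  Σ[ π ∈ Permutation′ (q * n + r) ] ∃[ α ] ∃[ χ ]
    IsIndependenceNumber (hasseDiagram π) α × IsChromaticNumber (hasseDiagram π) χ ×
    α ≤ q * u + r × q * n + r ≤ χ * α
hasse-graph q r {u = u} P =
  ranking , proj₁ independenceNumber , proj₁ chromaticNumber ,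
  proj₂ independenceNumber , proj₂ chromaticNumber , α-small (proj₂ independenceNumber) ,
  order≤χ*α (proj₂ independenceNumber) (proj₂ chromaticNumber)
  where
  open Blocks q r P
  open Ranking keys keys-injective
  open Extremal (hasseDiagram ranking) (λ i j → covers? ranking i j ⊎-dec covers? ranking j i)

  α-small : ∀ {α} → IsIndependenceNumber (hasseDiagram ranking) α → α ≤ q * u + r
  α-small ((S , indep , refl) , _) = ≤-trans (≤-reflexive (∣∣≡card S))
    (card-blocks (lookup S) λ i j Si Sj c →
      indep i j (lookup⇒[]= i S Si) (lookup⇒[]= j S Sj) (inj₁ (covered⇒covers c)))

-- Arithmetic of powers, and the smallest configurations.

^-distribʳ-* : ∀ a b n → (a * b) ^ n ≡ a ^ n * b ^ n
^-distribʳ-* a b zero    = refl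
^-distribʳ-* a b (suc n) =
  trans (cong (a * b *_) (^-distribʳ-* a b n)) ([m*n]*[o*p]≡[m*o]*[n*p] a b (a ^ n) (b ^ n))

^-swap : ∀ a m n → (a ^ m) ^ n ≡ (a ^ n) ^ m
^-swap a m n = trans (^-*-assoc a m n) (trans (cong (a ^_) (*-comm m n)) (sym (^-*-assoc a n m)))

square-cancel-≤ : ∀ {a b} → a * a ≤ b * b → a ≤ b
square-cancel-≤ le = ≮⇒≥ (λ b<a → <⇒≱ (*-mono-< b<a b<a) le)

singleton : Configuration 1 1 1
singleton = record
  { key       = id
  ; injective = id
  ; container = λ _ _ → true
  ; small     = λ _ → ≤-refl
  ; cover     = λ S _ → zero , λ _ _ → refl
  }

-- A single edge. Blocks of it serve the orders below `threshold-size 1`, for which density 4/5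
-- suffices.
chain₂ : Configuration 2 2 1
chain₂ = record
  { key       = id
  ; injective = id
  ; container = only
  ; small     = λ { 0F → ≤-refl ; 1F → ≤-refl }
  ; cover     = cover
  }
  where
  only : Fin 2 → Fin 2 → Bool
  only 0F 0F = true
  only 0F 1F = false
  only 1F 0F = false
  only 1F 1F = true

  cover : ∀ S → Independent {2} id S → ∃[ t ] S ⊆ only t
  cover S indep with S 0F in S0
  ... | false = 1F , λ { 0F S0′ → contradiction (trans (sym S0) S0′) λ () ; 1F _ → refl }
  ... | true  = 0F , λ { 0F _ → refl
                       ; 1F S1 → contradiction edge (indep 0F 1F S0 S1) }
    where
    edge : Covered {2} id 0F 1F
    edge = s≤s z≤n , s≤s z≤n , λ { 0F () _ _ _ ; 1F _ (s≤s ()) _ _ }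

-- Iterating the amplification `k` times.

module Iterate (q ℓ k : ℕ) (q-large : suc (5 * q) ≤ 2 ^ ℓ) (ℓ-small : k * ℓ * 2 ^ k ≤ q) where
  -- With `5 * q` columns, the passage from size bound `u` to `4 * q * u` lowers the density by
  -- exactly 4/5.
  m : ℕ
  m = 5 * q

  κ : ℕ → ℕ
  κ zero    = 1
  κ (suc s) = κ s ^ m * suc m ^ (m ^ s)

  -- Measured in units of `m ^ s`, the exponent grows by `ℓ` per level: each of the `m ^ s` rows has
  -- at most `2 ^ ℓ` cuts, and the power `m` from the columns only changes the unit. Bounding
  -- `κ s ^ m` instead of `κ s` avoids the exponent `s - 1`.
  κ-suc : ∀ s → κ s ^ m ≤ 2 ^ (s * ℓ * m ^ s) → κ (suc s) ≤ 2 ^ (suc s * ℓ * m ^ s)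
  κ-suc s hyp = begin
    κ s ^ m * suc m ^ (m ^ s)              ≤⟨ *-mono-≤ hyp (^-monoˡ-≤ (m ^ s) q-large) ⟩
    2 ^ (s * ℓ * m ^ s) * (2 ^ ℓ) ^ m ^ s  ≡⟨ cong (2 ^ (s * ℓ * m ^ s) *_) (^-*-assoc 2 ℓ (m ^ s)) ⟩
    2 ^ (s * ℓ * m ^ s) * 2 ^ (ℓ * m ^ s)  ≡⟨ ^-distribˡ-+-* 2 (s * ℓ * m ^ s) (ℓ * m ^ s) ⟨
    2 ^ (s * ℓ * m ^ s + ℓ * m ^ s)        ≡⟨ cong (2 ^_) (collect s ℓ (m ^ s)) ⟩
    2 ^ (suc s * ℓ * m ^ s)                ∎
    where
    open ≤-Reasoning
    collect : ∀ s ℓ x → s * ℓ * x + ℓ * x ≡ (1 + s) * ℓ * x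
    collect = solve-∀

  κ-bound : ∀ s → κ s ^ m ≤ 2 ^ (s * ℓ * m ^ s)
  κ-bound zero    = ≤-reflexive (^-zeroˡ m)
  κ-bound (suc s) = begin
    κ (suc s) ^ m                  ≤⟨ ^-monoˡ-≤ m (κ-suc s (κ-bound s)) ⟩
    (2 ^ (suc s * ℓ * m ^ s)) ^ m  ≡⟨ ^-*-assoc 2 (suc s * ℓ * m ^ s) m ⟩
    2 ^ (suc s * ℓ * m ^ s * m)    ≡⟨ cong (2 ^_) (collect (suc s * ℓ) (m ^ s) m) ⟩
    2 ^ (suc s * ℓ * m ^ suc s)    ∎
    where
    open ≤-Reasoning
    collect : ∀ a x m → a * x * m ≡ a * (m * x)
    collect = solve-∀

  5^s≤ : ∀ {s} → s < k → 5 ^ s ≤ 2 ^ k * 4 ^ s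
  5^s≤ {s} s<k = begin
    5 ^ s          ≤⟨ ^-monoˡ-≤ s (m≤m+n 5 3) ⟩
    8 ^ s          ≡⟨ ^-distribʳ-* 2 4 s ⟩
    2 ^ s * 4 ^ s  ≤⟨ *-monoˡ-≤ (4 ^ s) (^-monoʳ-≤ 2 (<⇒≤ s<k)) ⟩
    2 ^ k * 4 ^ s  ∎
    where open ≤-Reasoning

  -- The number of choices has an exponent of order `(5 * q) ^ s`, whereas sizes are of order
  -- `(4 * q) ^ s`. The ratio `(5/4) ^ s` is at most `2 ^ k`, and a single factor `q` absorbs it
  -- together with `k * ℓ`.
  exponent-small : ∀ {s} → s < k → suc s * ℓ * m ^ s ≤ q * (4 * q) ^ s
  exponent-small {s} s<k = begin
    suc s * ℓ * m ^ s                  ≡⟨ cong (suc s * ℓ *_) (^-distribʳ-* 5 q s) ⟩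
    suc s * ℓ * (5 ^ s * q ^ s)        ≤⟨ *-mono-≤ (*-monoˡ-≤ ℓ s<k) (*-monoˡ-≤ (q ^ s) (5^s≤ s<k)) ⟩
    k * ℓ * (2 ^ k * 4 ^ s * q ^ s)    ≡⟨ collect (k * ℓ) (2 ^ k) (4 ^ s) (q ^ s) ⟩
    k * ℓ * 2 ^ k * (4 ^ s * q ^ s)    ≤⟨ *-monoˡ-≤ (4 ^ s * q ^ s) ℓ-small ⟩
    q * (4 ^ s * q ^ s)                ≡⟨ cong (q *_) (^-distribʳ-* 4 q s) ⟨
    q * (4 * q) ^ s                    ∎
    where
    open ≤-Reasoning
    collect : ∀ a b c d → a * (b * c * d) ≡ a * b * (c * d)
    collect = solve-∀

  -- As powers of two, the choices cost `q * u` and the fair bits `5 * q * u`. By `2 ^ 6 ≤ 3 ^ 4`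
  -- these six units are worth four in base 3.
  enough : ∀ {s} → s < k → κ s ^ m * suc m ^ (m ^ s) * 2 ^ (m * (4 * q) ^ s) ≤ 3 ^ (4 * q) ^ suc s
  enough {s} s<k = begin
    κ (suc s) * 2 ^ (m * u)          ≤⟨ *-monoˡ-≤ _ (κ-suc s (κ-bound s)) ⟩
    2 ^ (suc s * ℓ * m ^ s) * 2 ^ (m * u)
                                     ≤⟨ *-monoˡ-≤ _ (^-monoʳ-≤ 2 (exponent-small s<k)) ⟩
    2 ^ (q * u) * 2 ^ (m * u)        ≡⟨ ^-distribˡ-+-* 2 (q * u) (m * u) ⟨
    2 ^ (q * u + 5 * q * u)          ≡⟨ cong (2 ^_) (six q u) ⟩
    2 ^ (6 * (q * u))                ≡⟨ ^-*-assoc 2 6 (q * u) ⟨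
    64 ^ (q * u)                     ≤⟨ ^-monoˡ-≤ (q * u) (m≤m+n 64 17) ⟩
    81 ^ (q * u)                     ≡⟨ ^-*-assoc 3 4 (q * u) ⟩
    3 ^ (4 * (q * u))                ≡⟨ cong (3 ^_) (*-assoc 4 q u) ⟨
    3 ^ (4 * q * u)                  ∎
    where
    open ≤-Reasoning
    u = (4 * q) ^ s
    six : ∀ q u → q * u + 5 * q * u ≡ 6 * (q * u)
    six = solve-∀

  level : ∀ s → s ≤ k → Configuration (m ^ s) (κ s) ((4 * q) ^ s)
  level zero    _   = singleton
  level (suc s) s<k = amplify m (level s (<⇒≤ s<k)) (enough s<k)

-- Choice of the parameters: `q = width k` and `ℓ = 3 * k + 6`.

width : ℕ → ℕ
width k = 2 ^ (3 * k + 3)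

order : ℕ → ℕ
order k = (5 * width k) ^ k

bound : ℕ → ℕ
bound k = (4 * width k) ^ k

n<2^n : ∀ n → n < 2 ^ n
n<2^n zero    = ≤-refl
n<2^n (suc n) = begin-strict
  suc n            <⟨ s<s (n<2^n n) ⟩
  1 + 2 ^ n        ≤⟨ +-monoˡ-≤ (2 ^ n) (m^n>0 2 n) ⟩
  2 ^ n + 2 ^ n    ≡⟨ cong (λ x → 2 ^ n + x) (+-identityʳ (2 ^ n)) ⟨
  2 ^ suc n        ∎
  where open ≤-Reasoning

width-large : ∀ k → suc (5 * width k) ≤ 2 ^ (3 * k + 6)
width-large k = begin
  suc (5 * w)       ≤⟨ +-monoˡ-≤ (5 * w) (m^n>0 2 (3 * k + 3)) ⟩
  w + 5 * w         ≤⟨ *-monoˡ-≤ w (m≤m+n 6 2) ⟩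
  8 * w             ≡⟨ ^-distribˡ-+-* 2 3 (3 * k + 3) ⟨
  2 ^ (3 + (3 * k + 3)) ≡⟨ cong (2 ^_) (shift k) ⟩
  2 ^ (3 * k + 6)   ∎
  where
  open ≤-Reasoning
  w = width k
  shift : ∀ k → 3 + (3 * k + 3) ≡ 3 * k + 6
  shift = solve-∀

-- This dictates `3 * k + 3`: the factors are at most `2 ^ k`, `8 * 2 ^ k` and `2 ^ k`.
width-small : ∀ k → k * (3 * k + 6) * 2 ^ k ≤ width k
width-small k = begin
  k * (3 * k + 6) * p     ≤⟨ *-monoˡ-≤ p (*-mono-≤ (<⇒≤ (n<2^n k)) 3k+6≤) ⟩
  p * (8 * p) * p         ≡⟨ collect p ⟩
  8 * (p ^ 3)             ≡⟨ cong (8 *_) (trans (^-swap 2 k 3) (^-*-assoc 2 3 k)) ⟩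
  2 ^ 3 * 2 ^ (3 * k)     ≡⟨ ^-distribˡ-+-* 2 3 (3 * k) ⟨
  2 ^ (3 + 3 * k)         ≡⟨ cong (2 ^_) (+-comm 3 (3 * k)) ⟩
  width k                 ∎
  where
  open ≤-Reasoning
  p = 2 ^ k
  collect : ∀ p → p * (8 * p) * p ≡ 8 * (p * (p * (p * 1)))
  collect = solve-∀
  expand : ∀ k → 3 * k + 6 + 3 * k ≡ 6 * (1 + k)
  expand = solve-∀
  3k+6≤ : 3 * k + 6 ≤ 8 * p
  3k+6≤ = begin
    3 * k + 6          ≤⟨ m≤m+n (3 * k + 6) (3 * k) ⟩
    3 * k + 6 + 3 * k  ≡⟨ expand k ⟩
    6 * (1 + k)        ≤⟨ *-mono-≤ (m≤m+n 6 2) (n<2^n k) ⟩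
    8 * p              ∎

sparse : ∀ k → ∃[ κ ] Configuration (order k) κ (bound k)
sparse k = κ k , level k ≤-refl
  where open Iterate (width k) (3 * k + 6) k (width-large k) (width-small k)

bound-density : ∀ k → bound k * 5 ^ k ≡ order k * 4 ^ k
bound-density k = begin
  (4 * w) ^ k * 5 ^ k      ≡⟨ cong (_* 5 ^ k) (^-distribʳ-* 4 w k) ⟩
  4 ^ k * w ^ k * 5 ^ k    ≡⟨ collect (4 ^ k) (w ^ k) (5 ^ k) ⟩
  5 ^ k * w ^ k * 4 ^ k    ≡⟨ cong (_* 4 ^ k) (^-distribʳ-* 5 w k) ⟨
  (5 * w) ^ k * 4 ^ k      ∎
  where
  open ≡-Reasoning
  w = width k
  collect : ∀ a b c → a * b * c ≡ c * b * a
  collect = solve-∀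

order≤ : ∀ k → order k ≤ 2 ^ ((3 * k + 6) * k)
order≤ k = begin
  (5 * width k) ^ k         ≤⟨ ^-monoˡ-≤ k (≤-trans (n≤1+n _) (width-large k)) ⟩
  (2 ^ (3 * k + 6)) ^ k     ≡⟨ ^-*-assoc 2 (3 * k + 6) k ⟩
  2 ^ ((3 * k + 6) * k)     ∎
  where open ≤-Reasoning

order-nonZero : ∀ k → NonZero (order k)
order-nonZero k = m^n≢0 (5 * width k) k {{m*n≢0 5 (width k) {{_}} {{m^n≢0 2 (3 * k + 3)}}}}

-- Arbitrary orders.

-- A set of n points is cut into blocks with K + 4 levels each: as 2 * (4/5)^4 ≤ 1, the full
-- blocks contribute at most n (4/5)^K / 2 to an independent set, and from this size on the
-- incomplete last block at most as much.
threshold-size : ℕ → ℕ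
threshold-size K = 2 ^ suc K * order (4 + K)

threshold-size-exponent : ℕ → ℕ
threshold-size-exponent K = suc K + (3 * (4 + K) + 6) * (4 + K)

threshold-size≤ : ∀ K → threshold-size K ≤ 2 ^ threshold-size-exponent K
threshold-size≤ K = ≤-trans (*-monoʳ-≤ (2 ^ suc K) (order≤ (4 + K)))
  (≤-reflexive (sym (^-distribˡ-+-* 2 (suc K) _)))

n<threshold-size : ∀ n → n < threshold-size n
n<threshold-size n = <-≤-trans (<-trans (n<1+n n) (n<2^n (suc n)))
  (m≤m*n (2 ^ suc n) (order (4 + n)) {{order-nonZero (4 + n)}})

-- A downward search from an index where `f` exceeds `n`: the first index with `f ≤ n` is just below
-- one with `n < f`.
bracket : ∀ (f : ℕ → ℕ) n j → n < f (suc j) → n < f 1 ⊎ ∃[ i ] f (suc i) ≤ n × n < f (suc (suc i))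
bracket f n zero    n<f = inj₁ n<f
bracket f n (suc j) n<f with f (suc j) ≤? n
... | yes f≤n = inj₂ (j , f≤n , n<f)
... | no  f≰n = bracket f n j (≰⇒> f≰n)

-- Here `n≤` says that √(log₂ n) is at most `13 * K`, so the density `(4/5) ^ K` in `dense` is
-- exponentially small in √(log₂ n).
record Construction (n : ℕ) : Set where
  field
    K             : ℕ
    {N κ u}       : ℕ
    blocks        : Configuration N κ u
    count rest    : ℕ
    split         : count * N + rest ≡ n
    n≤            : n ≤ 2 ^ ((13 * K) * (13 * K))
    dense         : (count * u + rest) * 5 ^ K ≤ n * 4 ^ K

split-blocks : ∀ n N .{{_ : NonZero N}} → (n / N) * N + n % N ≡ n
split-blocks n N = trans (+-comm ((n / N) * N) (n % N)) (sym (m≡m%n+[m/n]*n n N))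

-- A single point cannot have density 4/5, hence `K = 0`.
trivial-construction : Construction 1
trivial-construction = record
  { K = 0 ; blocks = singleton ; count = 0 ; rest = 1 ; split = refl ; n≤ = ≤-refl ; dense = ≤-refl }

chain-construction : ∀ n → 2 ≤ n → n < threshold-size 1 → Construction n
chain-construction n 2≤n n<f = record
  { K = 1 ; blocks = chain₂ ; count = n / 2 ; rest = n % 2 ; split = split-blocks n 2
  -- `threshold-size-exponent 1` is 107, and `13 * 13 = 107 + 62`.
  ; n≤ = ≤-trans (<⇒≤ n<f) (≤-trans (threshold-size≤ 1) (^-monoʳ-≤ 2 (m≤m+n 107 62)))
  ; dense = dense
  }
  where
  open ≤-Reasoning
  count>0 : ∀ c r → r < 2 → c * 2 + r ≡ n → 1 ≤ c
  count>0 zero    r r<2 refl = contradiction 2≤n (<⇒≱ r<2)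
  count>0 (suc c) r r<2 _    = s≤s z≤n

  regroup : ∀ c r → (c * 1 + r) * 5 ≡ 5 * c + 4 * r + r
  regroup = solve-∀
  regroup′ : ∀ c r → 5 * c + 4 * r + 3 * c ≡ (c * 2 + r) * 4
  regroup′ = solve-∀

  -- For `c` pairs and `r` leftover points, `5 * (c + r) ≤ 4 * (2 * c + r)` amounts to `r ≤ 3 * c`.
  rest≤ : n % 2 ≤ 3 * (n / 2)
  rest≤ = begin
    n % 2          ≤⟨ s≤s⁻¹ (m%n<n n 2) ⟩
    1              ≤⟨ count>0 (n / 2) (n % 2) (m%n<n n 2) (split-blocks n 2) ⟩
    n / 2          ≤⟨ m≤m+n (n / 2) _ ⟩
    3 * (n / 2)    ∎

  dense : (n / 2 * 1 + n % 2) * 5 ≤ n * 4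
  dense = begin
    (n / 2 * 1 + n % 2) * 5                    ≡⟨ regroup (n / 2) (n % 2) ⟩
    5 * (n / 2) + 4 * (n % 2) + n % 2          ≤⟨ +-monoʳ-≤ (5 * (n / 2) + 4 * (n % 2)) rest≤ ⟩
    5 * (n / 2) + 4 * (n % 2) + 3 * (n / 2)    ≡⟨ regroup′ (n / 2) (n % 2) ⟩
    (n / 2 * 2 + n % 2) * 4                    ≡⟨ cong (_* 4) (split-blocks n 2) ⟩
    n * 4                                      ∎

-- The origin of 13: at `i = 0` the left side is 147, just above the square of 12. The difference of
-- the two sides is a polynomial in `i` with positive coefficients.
exponent≤ : ∀ i → threshold-size-exponent (2 + i) ≤ 13 * (1 + i) * (13 * (1 + i))
exponent≤ i = ≤-trans (m≤m+n _ (166 * (i * i) + 295 * i + 22)) (≤-reflexive (expand i))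
  where
  expand : ∀ i → (3 + i) + (3 * (6 + i) + 6) * (6 + i) + (166 * (i * i) + 295 * i + 22)
    ≡ 13 * (1 + i) * (13 * (1 + i))
  expand = solve-∀

blocks-dense : ∀ K N u c r n → u * 5 ^ (4 + K) ≡ N * 4 ^ (4 + K) → r ≤ N → c * N + r ≡ n →
  2 ^ suc K * N ≤ n → (c * u + r) * 5 ^ K ≤ n * 4 ^ K
blocks-dense K N u c r n u-dense r≤N split large = *-cancelˡ-≤ 2 dense
  where
  open ≤-Reasoning

  density : 2 * (u * 5 ^ K) ≤ N * 4 ^ K
  density = *-cancelˡ-≤ 256 (begin
    256 * (2 * (u * 5 ^ K))    ≡⟨ *-assoc 256 2 (u * 5 ^ K) ⟨
    512 * (u * 5 ^ K)          ≤⟨ *-monoˡ-≤ (u * 5 ^ K) (m≤m+n 512 113) ⟩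
    625 * (u * 5 ^ K)          ≡⟨ move 625 u (5 ^ K) ⟩
    u * (625 * 5 ^ K)          ≡⟨ cong (u *_) (^-distribˡ-+-* 5 4 K) ⟨
    u * 5 ^ (4 + K)            ≡⟨ u-dense ⟩
    N * 4 ^ (4 + K)            ≡⟨ cong (N *_) (^-distribˡ-+-* 4 4 K) ⟩
    N * (256 * 4 ^ K)          ≡⟨ move 256 N (4 ^ K) ⟨
    256 * (N * 4 ^ K)          ∎)
    where
    move : ∀ a b c → a * (b * c) ≡ b * (a * c)
    move = solve-∀

  remainder : 2 * (r * 5 ^ K) ≤ n * 4 ^ K
  remainder = begin
    -- Replacing `5 ^ K` by `8 ^ K` costs a factor `2 ^ K` beyond `4 ^ K`; `large` pays for it and
    -- for the leading 2, whence the `2 ^ suc K` in `threshold-size`.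
    2 * (r * 5 ^ K)            ≤⟨ *-monoʳ-≤ 2 (*-mono-≤ r≤N (^-monoˡ-≤ K (m≤m+n 5 3))) ⟩
    2 * (N * 8 ^ K)            ≡⟨ cong (λ x → 2 * (N * x)) (^-distribʳ-* 2 4 K) ⟩
    2 * (N * (2 ^ K * 4 ^ K))  ≡⟨ collect N (2 ^ K) (4 ^ K) ⟩
    2 * 2 ^ K * N * 4 ^ K      ≤⟨ *-monoˡ-≤ (4 ^ K) large ⟩
    n * 4 ^ K                  ∎
    where
    collect : ∀ n a b → 2 * (n * (a * b)) ≡ 2 * a * n * b
    collect = solve-∀

  dense : 2 * ((c * u + r) * 5 ^ K) ≤ 2 * (n * 4 ^ K)
  dense = begin
    2 * ((c * u + r) * 5 ^ K)                    ≡⟨ expand c u r (5 ^ K) ⟩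
    c * (2 * (u * 5 ^ K)) + 2 * (r * 5 ^ K)      ≤⟨ +-mono-≤ (*-monoʳ-≤ c density) remainder ⟩
    c * (N * 4 ^ K) + n * 4 ^ K                  ≡⟨ cong (_+ n * 4 ^ K) (*-assoc c N (4 ^ K)) ⟨
    c * N * 4 ^ K + n * 4 ^ K                    ≤⟨ +-monoˡ-≤ (n * 4 ^ K) (*-monoˡ-≤ (4 ^ K) c*N≤n) ⟩
    n * 4 ^ K + n * 4 ^ K                        ≡⟨ cong (λ x → n * 4 ^ K + x) (+-identityʳ (n * 4 ^ K)) ⟨
    2 * (n * 4 ^ K)                              ∎
    where
    expand : ∀ c u r x → 2 * ((c * u + r) * x) ≡ c * (2 * (u * x)) + 2 * (r * x)
    expand = solve-∀
    c*N≤n : c * N ≤ n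
    c*N≤n = ≤-trans (m≤m+n (c * N) r) (≤-reflexive split)

sparse-construction : ∀ n i → threshold-size (suc i) ≤ n → n < threshold-size (suc (suc i)) → Construction n
sparse-construction n i f≤n n<f = record
  { K = K ; blocks = proj₂ (sparse (4 + K)) ; count = n / N ; rest = n % N ; split = split-blocks n N
  ; n≤ = ≤-trans (<⇒≤ n<f) (≤-trans (threshold-size≤ (suc K))
      (^-monoʳ-≤ 2 {threshold-size-exponent (suc K)} (exponent≤ i)))
  ; dense = blocks-dense K N (bound (4 + K)) (n / N) (n % N) n
      (bound-density (4 + K)) (<⇒≤ (m%n<n n N)) (split-blocks n N) f≤n
  }
  where
  K = suc i
  N = order (4 + K)
  instance
    N-nonZero : NonZero N
    N-nonZero = order-nonZero (4 + K)

construction-from-2 : ∀ n → 2 ≤ n → Construction n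
construction-from-2 n 2≤n =
  [ chain-construction n 2≤n , (λ (i , f≤n , n<f) → sparse-construction n i f≤n n<f) ]′
    (bracket threshold-size n n (<-trans (n<1+n n) (n<threshold-size (suc n))))

construction : ∀ n .{{_ : NonZero n}} → Construction n
construction 1             = trivial-construction
construction (suc (suc n)) = construction-from-2 (suc (suc n)) (s≤s (s≤s z≤n))

-- From density and order to the two bounds of the theorem.

module Exponents {α n K a b : ℕ} (dense : α * 5 ^ K ≤ n * 4 ^ K) (n≤ : n ≤ 2 ^ ((13 * K) * (13 * K)))
  (a/b≤ : 2 ^ ((a * 52) * (a * 52)) ≤ n ^ ((b * 1) * (b * 1))) where
  open ≤-Reasoning

  -- From `52 * a / b ≤ √(log₂ n) ≤ 13 * K`, after removing the base 2, the squares and the common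
  -- factor 13.
  4a≤Kb : 4 * a ≤ K * b
  4a≤Kb = *-cancelˡ-≤ {4 * a} {K * b} 13 (square-cancel-≤ (^-cancelʳ-≤ 2
    {13 * (4 * a) * (13 * (4 * a))} {13 * (K * b) * (13 * (K * b))} ≤-refl (begin
    2 ^ (13 * (4 * a) * (13 * (4 * a)))      ≡⟨ cong (2 ^_) (52a a) ⟩
    2 ^ (a * 52 * (a * 52))                  ≤⟨ a/b≤ ⟩
    n ^ (b * 1 * (b * 1))                    ≤⟨ ^-monoˡ-≤ (b * 1 * (b * 1)) n≤ ⟩
    (2 ^ (13 * K * (13 * K))) ^ (b * 1 * (b * 1))  ≡⟨ ^-*-assoc 2 (13 * K * (13 * K)) _ ⟩
    2 ^ (13 * K * (13 * K) * (b * 1 * (b * 1)))    ≡⟨ cong (2 ^_) (13Kb K b) ⟩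
    2 ^ (13 * (K * b) * (13 * (K * b)))      ∎)))
    where
    52a : ∀ a → 13 * (4 * a) * (13 * (4 * a)) ≡ a * 52 * (a * 52)
    52a = solve-∀
    13Kb : ∀ K b → 13 * K * (13 * K) * (b * 1 * (b * 1)) ≡ 13 * (K * b) * (13 * (K * b))
    13Kb = solve-∀

  -- Since `2 * 4 ^ 4 = 512 ≤ 625 = 5 ^ 4`, `2 ^ a` is at most `(5/4) ^ (4 * a)`; the remaining `d`
  -- factors 5/4 only help.
  2^a≤[5/4]^Kb : 2 ^ a * 4 ^ (K * b) ≤ 5 ^ (K * b)
  2^a≤[5/4]^Kb = subst (λ x → 2 ^ a * 4 ^ x ≤ 5 ^ x) (m+[n∸m]≡n 4a≤Kb) (begin
    2 ^ a * 4 ^ (4 * a + d)          ≡⟨ cong (2 ^ a *_) (^-distribˡ-+-* 4 (4 * a) d) ⟩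
    2 ^ a * (4 ^ (4 * a) * 4 ^ d)    ≡⟨ *-assoc (2 ^ a) (4 ^ (4 * a)) (4 ^ d) ⟨
    2 ^ a * 4 ^ (4 * a) * 4 ^ d      ≡⟨ cong (λ x → 2 ^ a * x * 4 ^ d) (^-*-assoc 4 4 a) ⟨
    2 ^ a * 256 ^ a * 4 ^ d          ≡⟨ cong (_* 4 ^ d) (^-distribʳ-* 2 256 a) ⟨
    512 ^ a * 4 ^ d                  ≤⟨ *-mono-≤ (^-monoˡ-≤ a (m≤m+n 512 113)) (^-monoˡ-≤ d (n≤1+n 4)) ⟩
    625 ^ a * 5 ^ d                  ≡⟨ cong (_* 5 ^ d) (^-*-assoc 5 4 a) ⟩
    5 ^ (4 * a) * 5 ^ d              ≡⟨ ^-distribˡ-+-* 5 (4 * a) d ⟨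
    5 ^ (4 * a + d)                  ∎)
    where
    d = K * b ∸ 4 * a

  α^b*2^a≤n^b : α ^ b * 2 ^ a ≤ n ^ b
  α^b*2^a≤n^b = *-cancelʳ-≤ (α ^ b * 2 ^ a) (n ^ b) (4 ^ (K * b)) {{m^n≢0 4 (K * b)}} (begin
    α ^ b * 2 ^ a * 4 ^ (K * b)      ≡⟨ *-assoc (α ^ b) (2 ^ a) (4 ^ (K * b)) ⟩
    α ^ b * (2 ^ a * 4 ^ (K * b))    ≤⟨ *-monoʳ-≤ (α ^ b) 2^a≤[5/4]^Kb ⟩
    α ^ b * 5 ^ (K * b)              ≡⟨ cong (α ^ b *_) (^-*-assoc 5 K b) ⟨
    α ^ b * (5 ^ K) ^ b              ≡⟨ ^-distribʳ-* α (5 ^ K) b ⟨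
    (α * 5 ^ K) ^ b                  ≤⟨ ^-monoˡ-≤ b dense ⟩
    (n * 4 ^ K) ^ b                  ≡⟨ ^-distribʳ-* n (4 ^ K) b ⟩
    n ^ b * (4 ^ K) ^ b              ≡⟨ cong (n ^ b *_) (^-*-assoc 4 K b) ⟩
    n ^ b * 4 ^ (K * b)              ∎)

-- The value is 1/52, as the denominator is stored less one. In `52 = 13 * 4`, 13 comes from `n≤`
-- and 4 from `2 ≤ (5/4) ^ 4`.
constant : ℚ
constant = ℚ.mkℚ (ℤ.+ 1) 51 (1-coprimeTo 52)

independence-bound : ∀ {α} n K → α * 5 ^ K ≤ n * 4 ^ K → n ≤ 2 ^ ((13 * K) * (13 * K)) →
  α ≤ n ·2^- (constant · √ log₂ n)
independence-bound {α} n K dense n≤ a b a/b≤ = Exponents.α^b*2^a≤n^b {α} {n} {K} {a} {b} dense n≤ a/b≤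

-- `n ≤ χ * α` turns an upper bound on `α` into a lower bound on `χ` once `α ^ b` is cancelled;
-- `α = 0` would force `n = 0`.
chromatic-bound : ∀ {α n χ} x .{{_ : NonZero n}} → n ≤ χ * α → α ≤ n ·2^- x → 2^ x ≤ χ
chromatic-bound {zero} {n} {χ} x n≤χα _ =
  contradiction (n≤0⇒n≡0 (≤-trans n≤χα (≤-reflexive (*-zeroʳ χ)))) (≢-nonZero⁻¹ n)
chromatic-bound {α@(suc _)} {n} {χ} x n≤χα α-bound a b a/b≤x = *-cancelˡ-≤ (α ^ b) {{m^n≢0 α b}} (begin
  α ^ b * 2 ^ a    ≤⟨ α-bound a b a/b≤x ⟩
  n ^ b            ≤⟨ ^-monoˡ-≤ b n≤χα ⟩
  (χ * α) ^ b      ≡⟨ cong (_^ b) (*-comm χ α) ⟩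
  (α * χ) ^ b      ≡⟨ ^-distribʳ-* α χ b ⟩
  α ^ b * χ ^ b    ∎)
  where open ≤-Reasoning

bounds : ∀ n K A .{{_ : NonZero n}} → A * 5 ^ K ≤ n * 4 ^ K → n ≤ 2 ^ ((13 * K) * (13 * K)) →
  (Σ[ π ∈ Permutation′ n ] ∃[ α ] ∃[ χ ]
    IsIndependenceNumber (hasseDiagram π) α × IsChromaticNumber (hasseDiagram π) χ ×
    α ≤ A × n ≤ χ * α) →
  Σ[ π ∈ Permutation′ n ] ∃[ α ] ∃[ χ ]
    IsIndependenceNumber (hasseDiagram π) α ×
    IsChromaticNumber (hasseDiagram π) χ ×
    (α ≤ n ·2^- (constant · √ log₂ n)) ×
    (2^ (constant · √ log₂ n) ≤ χ)
bounds n K A dense n≤ (π , α , χ , isα , isχ , α≤A , n≤χα) =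
  π , α , χ , isα , isχ , α-bound , chromatic-bound {α} {n} {χ} (constant · √ log₂ n) n≤χα α-bound
  where
  α-bound : α ≤ n ·2^- (constant · √ log₂ n)
  α-bound = independence-bound n K (≤-trans (*-monoˡ-≤ (5 ^ K) α≤A) dense) n≤

graph : ∀ n .{{_ : NonZero n}} → Construction n →
  Σ[ π ∈ Permutation′ n ] ∃[ α ] ∃[ χ ]
    IsIndependenceNumber (hasseDiagram π) α ×
    IsChromaticNumber (hasseDiagram π) χ ×
    (α ≤ n ·2^- (constant · √ log₂ n)) ×
    (2^ (constant · √ log₂ n) ≤ χ)
graph n record { K = K ; u = u ; blocks = P ; count = q ; rest = r ; split = refl
               ; n≤ = n≤ ; dense = dense } =
  bounds n K (q * u + r) dense n≤ (hasse-graph q r P)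

theorem2 :
    Σ[ c ∈ ℚ ] 0ℚ ℚ.< c ×
      (∀ (n : ℕ) .{{_ : NonZero n}} →
        Σ[ π ∈ Permutation′ n ] ∃[ α ] ∃[ χ ]
          IsIndependenceNumber (hasseDiagram π) α ×
          IsChromaticNumber (hasseDiagram π) χ ×
          (α ≤ n ·2^- (c · √ log₂ n)) ×
          (2^ (c · √ log₂ n) ≤ χ))
theorem2 = constant , ℚ.*<* (ℤ.+<+ (s≤s z≤n)) , λ n → graph n (construction n)
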